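{- There is no non-trivial cycle of length $6$.
   Context: The subprime Fibonacci rule: from positive integers $x,y$ with $s=x+y$, the next term is $s$ if $s$ is prime and $s/p$ if $s$ is composite, where $p$ is the smallest prime factor of $s$. A non-trivial cycle of length $m$ is an $m$-tuple $(t_1,\dots,t_m)$ of positive integers, indices read modulo $m$, such that for every $i$, $t_i$ is obtained from $t_{i-2},t_{i-1}$ by this rule, the $t_i$ are not all equal, and $m$ is the minimal period; equivalently it is the repeating block of an eventually periodic, not eventually constant, subprime Fibonacci sequence. -}

module Defs where

open import Data.Nat using (ℕ; zero; suc; _+_; _*_; _≤_; _<_)
open import Data.Nat.Divisibility using (_∣_)
open import Data.Nat.Primality using (Prime; Composite)
open import Data.Product using (_×_; Σ)
open import Data.Sum using (_⊎_)
open import Relation.Binary.PropositionalEquality using (_≡_; _≢_)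
open import Relation.Nullary using (¬_)

SmallestPrimeFactor : ℕ → ℕ → Set
SmallestPrimeFactor p s = Prime p × p ∣ s × (∀ q → Prime q → q ∣ s → p ≤ q)

SubprimeStep : ℕ → ℕ → ℕ → Set
SubprimeStep x y z =
  (Prime (x + y) × z ≡ x + y) ⊎
  (Composite (x + y) × Σ ℕ (λ p → SmallestPrimeFactor p (x + y) × z * p ≡ x + y))

record NontrivialCycle (m : ℕ) (t : ℕ → ℕ) : Set where
  field
    periodic  : ∀ i → t (i + m) ≡ t i
    positive  : ∀ i → 0 < t i
    rule      : ∀ i → SubprimeStep (t i) (t (suc i)) (t (suc (suc i)))
    nonconst  : Σ ℕ (λ i → Σ ℕ (λ j → t i ≢ t j))
    minimal   : ∀ k → 0 < k → k < m → ¬ (∀ i → t (i + k) ≡ t i)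

{-# OPTIONS --safe #-}

-- The six terms cannot all be halved sums, for each would then be the mean of its two
-- predecessors. After an even term come two odd terms, so up to rotation the parities are
-- EOOOOO or EOOEOO. In the first pattern the divisors p, q of the two odd sums satisfy
-- (16 p − 11) (16 q − 11) = 21², which has no odd solution. In the second, the linear map taking
-- the pair after one even term to the pair after the other, followed by its counterpart, fixes
-- the former pair. Its determinant is 1 / (4 p q r s), where p, q, r, s are the divisors of the odd
-- sums, so its trace is 1 + 1 / (4 p q r s). This Diophantine equation forces two of the four
-- divisors to be 1. Up to rotation eight quadruples remain; each fixes the cycle up to scale, a
-- term known to be prime fixes the scale, and some other term then breaks the rule.
module Submission where

open import Defs
open import Data.Nat
open import Data.Nat.Properties
open import Data.Nat.Divisibility
open import Data.Nat.Primality
open import Data.Nat.Tactic.RingSolver using (solve-∀)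
open import Data.Parity.Base as ℙ using (0ℙ; 1ℙ)
open import Data.Parity.Properties using (+-homo-+; *-homo-*)
open import Data.Product using (_×_; _,_; proj₁; proj₂)
open import Data.Sum using (_⊎_; inj₁; inj₂)
open import Data.Empty using (⊥-elim)
open import Function using (_∘_)
open import Relation.Nullary using (¬_; Dec; contradiction)
open import Relation.Nullary.Decidable
  using (True; toWitness; from-yes; from-no; ¬?; _→-dec_; _×-dec_; _⊎-dec_)
open import Relation.Binary.PropositionalEquality

-- Linear maps between the pairs that follow the even terms

-- The number by which the rule divides `s`. A prime sum counts as divided by 1, so both cases of
-- the rule take the form `z * p ≡ s`.
data Divisor (s : ℕ) : ℕ → Set where
  one   : Prime s → Divisor s 1
  least : ∀ {p} → Composite s → SmallestPrimeFactor p s → Divisor s p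

-- Consecutive terms x, y, b, u, v of which only b is even, so x + y is halved while r and s
-- divide the odd sums.
record Arc (x y r s u v : ℕ) : Set where
  constructor arc
  field
    b     : ℕ
    b-eq  : b * 2 ≡ x + y
    u-eq  : u * r ≡ y + b
    u-div : Divisor (y + b) r
    v-eq  : v * s ≡ b + u
    v-div : Divisor (b + u) s

-- With `arc-end`, this is the matrix of `(x , y) ↦ (u , v)` with denominators cleared.
arc-mid : ∀ {x y r s u v} → Arc x y r s u v → u * r * 2 ≡ x + 3 * y
arc-mid {x} {y} {r} {s} {u} (arc b b-eq u-eq _ _ _) = begin
  u * r * 2        ≡⟨ cong (_* 2) u-eq ⟩
  (y + b) * 2      ≡⟨ lemma₁ y b ⟩
  y * 2 + b * 2    ≡⟨ cong (y * 2 +_) b-eq ⟩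
  y * 2 + (x + y)  ≡⟨ lemma₂ x y ⟩
  x + 3 * y        ∎
  where
  open ≡-Reasoning
  lemma₁ : ∀ y b → (y + b) * 2 ≡ y * 2 + b * 2
  lemma₁ = solve-∀
  lemma₂ : ∀ x y → y * 2 + (x + y) ≡ x + 3 * y
  lemma₂ = solve-∀

arc-end : ∀ {x y r s u v} → Arc x y r s u v →
          v * s * r * 2 ≡ (r + 1) * x + (r + 3) * y
arc-end {x} {y} {r} {s} {u} {v} α@(arc b b-eq _ _ v-eq _) = begin
  v * s * r * 2                  ≡⟨ cong (λ n → n * r * 2) v-eq ⟩
  (b + u) * r * 2                ≡⟨ lemma₁ b u r ⟩
  b * 2 * r + u * r * 2          ≡⟨ cong₂ (λ m n → m * r + n) b-eq (arc-mid α) ⟩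
  (x + y) * r + (x + 3 * y)      ≡⟨ lemma₂ x y r ⟩
  (r + 1) * x + (r + 3) * y      ∎
  where
  open ≡-Reasoning
  lemma₁ : ∀ b u r → (b + u) * r * 2 ≡ b * 2 * r + u * r * 2
  lemma₁ = solve-∀
  lemma₂ : ∀ x y r → (x + y) * r + (x + 3 * y) ≡ (r + 1) * x + (r + 3) * y
  lemma₂ = solve-∀

-- The cycle is x, y, b, u, v, a with b and a the even terms.
record Alternating (p q r s x y u v : ℕ) : Set where
  constructor alternating
  field
    there : Arc x y r s u v
    back  : Arc u v p q x y
    x>0   : 0 < x
    u>0   : 0 < u

swap : ∀ {p q r s x y u v} → Alternating p q r s x y u v → Alternating r s p q u v x y
swap (alternating there back x>0 u>0) = alternating back there u>0 x>0

-- Abstract, as are prime-factor, quotient-value and collect, because with-abstraction would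
-- otherwise normalise the proof term.
abstract
  x-return : ∀ {p q r s x y u v} → Alternating p q r s x y u v →
             x * (4 * (p * r * s)) ≡ x * (s + 3 * r + 3) + y * (3 * s + 3 * r + 9)
  x-return {p} {q} {r} {s} {x} {y} {u} {v} (alternating there back _ _) = begin
    x * (4 * (p * r * s))                         ≡⟨ lemma₁ p r s x ⟩
    x * p * 2 * (r * s * 2)                       ≡⟨ cong (_* (r * s * 2)) (arc-mid back) ⟩
    (u + 3 * v) * (r * s * 2)                     ≡⟨ lemma₂ r s u v ⟩
    s * (u * r * 2) + 3 * (v * s * r * 2)         ≡⟨ cong₂ (λ m n → s * m + 3 * n) (arc-mid there) (arc-end there) ⟩
    s * (x + 3 * y) + 3 * ((r + 1) * x + (r + 3) * y)
                                                  ≡⟨ lemma₃ r s x y ⟩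
    x * (s + 3 * r + 3) + y * (3 * s + 3 * r + 9) ∎
    where
    open ≡-Reasoning
    lemma₁ : ∀ p r s x → x * (4 * (p * r * s)) ≡ x * p * 2 * (r * s * 2)
    lemma₁ = solve-∀
    lemma₂ : ∀ r s u v → (u + 3 * v) * (r * s * 2) ≡ s * (u * r * 2) + 3 * (v * s * r * 2)
    lemma₂ = solve-∀
    lemma₃ : ∀ r s x y → s * (x + 3 * y) + 3 * ((r + 1) * x + (r + 3) * y)
                         ≡ x * (s + 3 * r + 3) + y * (3 * s + 3 * r + 9)
    lemma₃ = solve-∀

-- Together with `x-return`, the rows of the composite map around the cycle, in the shape that
-- `fixed-trace` expects with `N = 4 * (p * r * s)`.
y-return : ∀ {p q r s x y u v} → Alternating p q r s x y u v →
           y * (4 * (p * r * s) * q) ≡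
           x * ((p + 1) * s + (p + 3) * (r + 1)) + y * (3 * (p + 1) * s + (p + 3) * (r + 3))
y-return {p} {q} {r} {s} {x} {y} {u} {v} (alternating there back _ _) = begin
  y * (4 * (p * r * s) * q)                     ≡⟨ lemma₁ p q r s y ⟩
  y * q * p * 2 * (r * s * 2)                   ≡⟨ cong (_* (r * s * 2)) (arc-end back) ⟩
  ((p + 1) * u + (p + 3) * v) * (r * s * 2)     ≡⟨ lemma₂ p r s u v ⟩
  (p + 1) * s * (u * r * 2) + (p + 3) * (v * s * r * 2)
    ≡⟨ cong₂ (λ m n → (p + 1) * s * m + (p + 3) * n) (arc-mid there) (arc-end there) ⟩
  (p + 1) * s * (x + 3 * y) + (p + 3) * ((r + 1) * x + (r + 3) * y)
    ≡⟨ lemma₃ p r s x y ⟩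
  x * ((p + 1) * s + (p + 3) * (r + 1)) + y * (3 * (p + 1) * s + (p + 3) * (r + 3)) ∎
  where
  open ≡-Reasoning
  lemma₁ : ∀ p q r s y → y * (4 * (p * r * s) * q) ≡ y * q * p * 2 * (r * s * 2)
  lemma₁ = solve-∀
  lemma₂ : ∀ p r s u v → ((p + 1) * u + (p + 3) * v) * (r * s * 2)
                         ≡ (p + 1) * s * (u * r * 2) + (p + 3) * (v * s * r * 2)
  lemma₂ = solve-∀
  lemma₃ : ∀ p r s x y → (p + 1) * s * (x + 3 * y) + (p + 3) * ((r + 1) * x + (r + 3) * y)
                         ≡ x * ((p + 1) * s + (p + 3) * (r + 1)) + y * (3 * (p + 1) * s + (p + 3) * (r + 3))
  lemma₃ = solve-∀

-- The matrix with rows (α , β) / N and (γ , δ) / (N q) fixes (x , y) and has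
-- determinant 1 / (N q), so its trace is 1 + 1 / (N q).
fixed-trace : ∀ {N q α β γ δ x y} → .{{NonZero N}} → .{{NonZero x}} →
              x * N ≡ x * α + y * β → y * (N * q) ≡ x * γ + y * δ →
              α * δ ≡ β * γ + N → N * q + 1 ≡ q * α + δ
fixed-trace {N} {q} {α} {β} {γ} {δ} {x} {y} x-eq y-eq det =
  -- The eigenvalue 1 makes 1 - trace + determinant vanish. Adding `x * (β * γ)` to both sides lets
  -- `det` be used without subtraction.
  *-cancelˡ-≡ (N * q + 1) (q * α + δ) (x * N) {{m*n≢0 x N}}
    (+-cancelʳ-≡ (x * (β * γ)) (x * N * (N * q + 1)) (x * N * (q * α + δ)) (begin
      x * N * (N * q + 1) + x * (β * γ)                      ≡⟨ lemma₁ N q β γ x ⟩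
      x * N * (N * q) + x * (β * γ + N)                      ≡⟨ cong₂ (λ m n → m * (N * q) + x * n) x-eq (sym det) ⟩
      (x * α + y * β) * (N * q) + x * (α * δ)                ≡⟨ lemma₂ N q α β δ x y ⟩
      x * α * (N * q) + β * (y * (N * q)) + x * (α * δ)      ≡⟨ cong (λ m → x * α * (N * q) + β * m + x * (α * δ)) y-eq ⟩
      x * α * (N * q) + β * (x * γ + y * δ) + x * (α * δ)    ≡⟨ lemma₃ N q α β γ δ x y ⟩
      x * N * (q * α) + (x * α + y * β) * δ + x * (β * γ)    ≡⟨ cong (λ m → x * N * (q * α) + m * δ + x * (β * γ)) (sym x-eq) ⟩
      x * N * (q * α) + x * N * δ + x * (β * γ)              ≡⟨ lemma₄ (x * N) (q * α) δ (x * (β * γ)) ⟩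
      x * N * (q * α + δ) + x * (β * γ)                      ∎))
  where
  open ≡-Reasoning
  lemma₁ : ∀ N q β γ x → x * N * (N * q + 1) + x * (β * γ) ≡ x * N * (N * q) + x * (β * γ + N)
  lemma₁ = solve-∀
  lemma₂ : ∀ N q α β δ x y → (x * α + y * β) * (N * q) + x * (α * δ)
                             ≡ x * α * (N * q) + β * (y * (N * q)) + x * (α * δ)
  lemma₂ = solve-∀
  lemma₃ : ∀ N q α β γ δ x y → x * α * (N * q) + β * (x * γ + y * δ) + x * (α * δ)
                               ≡ x * N * (q * α) + (x * α + y * β) * δ + x * (β * γ)
  lemma₃ = solve-∀
  lemma₄ : ∀ a b c d → a * b + a * c + d ≡ a * (b + c) + d
  lemma₄ = solve-∀

-- The trace equation and its solutions

-- The conclusion of `fixed-trace` for the return map to `(x , y)`.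
Balance : ℕ → ℕ → ℕ → ℕ → Set
Balance p q r s =
  4 * (p * r * s) * q + 1 ≡ q * (s + 3 * r + 3) + (3 * (p + 1) * s + (p + 3) * (r + 3))

balance : ∀ {p q r s x y u v} → .{{NonZero p}} → .{{NonZero r}} → .{{NonZero s}} →
          Alternating p q r s x y u v → Balance p q r s
balance {p} {q} {r} {s} {x} {y} α =
  fixed-trace {4 * (p * r * s)} {q} {s + 3 * r + 3} {3 * s + 3 * r + 9}
    {(p + 1) * s + (p + 3) * (r + 1)} {3 * (p + 1) * s + (p + 3) * (r + 3)} {x} {y}
    {{m*n≢0 4 (p * r * s) {{_}} {{m*n≢0 (p * r) s {{m*n≢0 p r}}}}}} {{>-nonZero (Alternating.x>0 α)}}
    (x-return α) (y-return α) (determinant p r s)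
  where
  determinant : ∀ p r s → (s + 3 * r + 3) * (3 * (p + 1) * s + (p + 3) * (r + 3))
                          ≡ (3 * s + 3 * r + 9) * ((p + 1) * s + (p + 3) * (r + 1)) + 4 * (p * r * s)
  determinant = solve-∀

-- The form `3 + i` turns the bound for odd primes into a shift of variables, after which
-- inequalities can be read off from coefficients.
data OddDivisor : ℕ → Set where
  unit  : OddDivisor 1
  large : ∀ i → Prime (3 + i) → OddDivisor (3 + i)

excess : ∀ {m n k} → m ≡ suc (n + k) → m ≢ n
excess {n = n} m≡ m≡n = m≢1+m+n n (trans (sym m≡n) m≡)

-- After the shift, left minus right is a polynomial with positive coefficients only. As `1 + i` is
-- any positive number, the case of four large divisors is covered too.
¬three-large : ∀ i j k l → ¬ Balance (1 + i) (3 + j) (3 + k) (3 + l)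
¬three-large i j k l = excess (lemma i j k l)
  where
  lemma : ∀ i j k l → 4 * ((1 + i) * (3 + k) * (3 + l)) * (3 + j) + 1 ≡
    suc ((3 + j) * ((3 + l) + 3 * (3 + k) + 3) + (3 * ((1 + i) + 1) * (3 + l) + ((1 + i) + 3) * ((3 + k) + 3))
      + (21 + 93 * i + 21 * j + 23 * k + 27 * l + 36 * i * j + 35 * i * k + 33 * i * l + 9 * j * k + 11 * j * l + 12 * k * l
         + 12 * i * j * k + 12 * i * j * l + 12 * i * k * l + 4 * j * k * l + 4 * i * j * k * l))
  lemma = solve-∀

¬three-large′ : ∀ i j k l → ¬ Balance (3 + i) (1 + j) (3 + k) (3 + l)
¬three-large′ i j k l = excess (lemma i j k l)
  where
  lemma : ∀ i j k l → 4 * ((3 + i) * (3 + k) * (3 + l)) * (1 + j) + 1 ≡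
    suc ((1 + j) * ((3 + l) + 3 * (3 + k) + 3) + (3 * ((3 + i) + 1) * (3 + l) + ((3 + i) + 3) * ((3 + k) + 3))
      + (21 + 21 * i + 93 * j + 27 * k + 23 * l + 36 * i * j + 11 * i * k + 9 * i * l + 33 * j * k + 35 * j * l + 12 * k * l
         + 12 * i * j * k + 12 * i * j * l + 4 * i * k * l + 12 * j * k * l + 4 * i * j * k * l))
  lemma = solve-∀

-- Here the right side is the larger one, by `21 + 3 * n`.
¬three-units : ∀ n → ¬ Balance n 1 1 1
¬three-units n = excess (lemma n) ∘ sym
  where
  lemma : ∀ n → 1 * (1 + 3 * 1 + 3) + (3 * (n + 1) * 1 + (n + 3) * (1 + 3)) ≡
                suc (4 * (n * 1 * 1) * 1 + 1 + (20 + 3 * n))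
  lemma = solve-∀

¬three-units′ : ∀ n → ¬ Balance 1 n 1 1
¬three-units′ n = excess (lemma n) ∘ sym
  where
  lemma : ∀ n → n * (1 + 3 * 1 + 3) + (3 * (1 + 1) * 1 + (1 + 3) * (1 + 3)) ≡
                suc (4 * (1 * 1 * 1) * n + 1 + (20 + 3 * n))
  lemma = solve-∀

-- Both `f i` and `f j` divide `c`, so `i` and `j` are at most `c` and a finite search decides the
-- claim.
divisor-search : ∀ {P : ℕ → ℕ → Set} (f : ℕ → ℕ) → (∀ i → i ≤ f i) →
                 ∀ c → .{{NonZero c}} → (P? : ∀ i j → Dec (P i j)) →
                 {True (allUpTo? (λ i → allUpTo? (λ j → (f i * f j ≟ c) →-dec P? i j) (suc c)) (suc c))} →
                 ∀ {i j} → f i * f j ≡ c → P i j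
divisor-search f i≤f c P? {found} {i} {j} eq =
  toWitness found (s≤s (≤-trans (i≤f i) (∣⇒≤ (divides (f j) (trans (sym eq) (*-comm (f i) (f j)))))))
                  (s≤s (≤-trans (i≤f j) (∣⇒≤ (divides (f i) (sym eq))))) eq

-- Factorises without subtraction: `K` collects the terms shared by both sides and `c` is a common
-- factor of the rest, which leaves a product equal to a constant.
cancel-balance : ∀ K m n c {L R} → .{{NonZero c}} → L ≡ K + m * c → R ≡ K + n * c → L ≡ R → m ≡ n
cancel-balance K m n c L≡ R≡ eq =
  *-cancelʳ-≡ m n c (+-cancelˡ-≡ K _ _ (trans (sym L≡) (trans eq R≡)))

data ProductNine : ℕ → ℕ → Set where
  3,11 : ProductNine 3 11
  5,5  : ProductNine 5 5
  11,3 : ProductNine 11 3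

product-nine : ∀ {i j} → (1 + i) * (1 + j) ≡ 9 → ProductNine (3 + i) (3 + j)
product-nine {i} {j} eq with
  divisor-search suc n≤1+n 9
    (λ i j → (i ≟ 0) ×-dec (j ≟ 8) ⊎-dec (i ≟ 2) ×-dec (j ≟ 2) ⊎-dec (i ≟ 8) ×-dec (j ≟ 0))
    {i = i} {j} eq
... | inj₁ (refl , refl)        = 3,11
... | inj₂ (inj₁ (refl , refl)) = 5,5
... | inj₂ (inj₂ (refl , refl)) = 11,3

-- (q − 2) (s − 2) = 9
balance-1q1s : ∀ i j → Balance 1 (3 + i) 1 (3 + j) → ProductNine (3 + i) (3 + j)
balance-1q1s i j = product-nine ∘ cancel-balance (9 * i + 9 * j + i * j + 34) ((1 + i) * (1 + j)) 9 3 (lhs i j) (rhs i j)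
  where
  lhs : ∀ i j → 4 * (1 * 1 * (3 + j)) * (3 + i) + 1 ≡ (9 * i + 9 * j + i * j + 34) + (1 + i) * (1 + j) * 3
  lhs = solve-∀
  rhs : ∀ i j → (3 + i) * ((3 + j) + 3 * 1 + 3) + (3 * (1 + 1) * (3 + j) + (1 + 3) * (1 + 3)) ≡ (9 * i + 9 * j + i * j + 34) + 9 * 3
  rhs = solve-∀

-- (p − 2) (r − 2) = 9
balance-p1r1 : ∀ i j → Balance (3 + i) 1 (3 + j) 1 → ProductNine (3 + i) (3 + j)
balance-p1r1 i j = product-nine ∘ cancel-balance (9 * i + 9 * j + i * j + 34) ((1 + i) * (1 + j)) 9 3 (lhs i j) (rhs i j)
  where
  lhs : ∀ i j → 4 * ((3 + i) * (3 + j) * 1) * 1 + 1 ≡ (9 * i + 9 * j + i * j + 34) + (1 + i) * (1 + j) * 3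
  lhs = solve-∀
  rhs : ∀ i j → 1 * (1 + 3 * (3 + j) + 3) + (3 * ((3 + i) + 1) * 1 + ((3 + i) + 3) * ((3 + j) + 3)) ≡ (9 * i + 9 * j + i * j + 34) + 9 * 3
  rhs = solve-∀

-- (4 r − 7) (4 s − 7) = 105
balance-11rs : ∀ i j → Balance 1 1 (3 + i) (3 + j) → (i ≡ 0 × j ≡ 4) ⊎ (i ≡ 4 × j ≡ 0)
balance-11rs i j eq =
  -- `5 + 4 * i` is 4 r - 7 at `r = 3 + i`. The equation is scaled by 4 to complete the product.
  divisor-search (λ i → 5 + 4 * i) (λ i → ≤-trans (m≤n*m i 4) (m≤n+m (4 * i) 5)) 105
    (λ i j → (i ≟ 0) ×-dec (j ≟ 4) ⊎-dec (i ≟ 4) ×-dec (j ≟ 0))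
    (cancel-balance (28 * i + 28 * j + 123) ((5 + 4 * i) * (5 + 4 * j)) 105 1 (lhs i j) (rhs i j) (cong (_* 4) eq))
  where
  lhs : ∀ i j → (4 * (1 * (3 + i) * (3 + j)) * 1 + 1) * 4 ≡ (28 * i + 28 * j + 123) + (5 + 4 * i) * (5 + 4 * j) * 1
  lhs = solve-∀
  rhs : ∀ i j → (1 * ((3 + j) + 3 * (3 + i) + 3) + (3 * (1 + 1) * (3 + j) + (1 + 3) * ((3 + i) + 3))) * 4 ≡ (28 * i + 28 * j + 123) + 105 * 1
  rhs = solve-∀

-- Treats `q = 3` apart, since the factor q - 4 is then negative; `¬balance-1q31` does the same for
-- `r = 3`.
¬balance-13r1 : ∀ r → ¬ Balance 1 3 r 1
¬balance-13r1 r = excess (lemma r) ∘ sym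
  where
  lemma : ∀ r → 3 * (1 + 3 * r + 3) + (3 * (1 + 1) * 1 + (1 + 3) * (r + 3)) ≡ suc (4 * (1 * r * 1) * 3 + 1 + (28 + r))
  lemma = solve-∀

¬balance-1q31 : ∀ q → ¬ Balance 1 q 3 1
¬balance-1q31 q = excess (lemma q) ∘ sym
  where
  lemma : ∀ q → q * (1 + 3 * 3 + 3) + (3 * (1 + 1) * 1 + (1 + 3) * (3 + 3)) ≡ suc (4 * (1 * 3 * 1) * q + 1 + (28 + q))
  lemma = solve-∀

-- (q − 4) (r − 4) = 33
balance-1qr1-product : ∀ i j → Balance 1 (4 + i) (4 + j) 1 → i * j ≡ 33
balance-1qr1-product i j =
  cancel-balance (16 * i + 16 * j + 3 * i * j + 65) (i * j) 33 1 (lhs i j) (rhs i j)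
  where
  lhs : ∀ i j → 4 * (1 * (4 + j) * 1) * (4 + i) + 1 ≡ (16 * i + 16 * j + 3 * i * j + 65) + i * j * 1
  lhs = solve-∀
  rhs : ∀ i j → (4 + i) * (1 + 3 * (4 + j) + 3) + (3 * (1 + 1) * 1 + (1 + 3) * ((4 + j) + 3)) ≡ (16 * i + 16 * j + 3 * i * j + 65) + 33 * 1
  rhs = solve-∀

factors-of-33 : ∀ i j → i * j ≡ 33 → (i ≡ 1 × j ≡ 33) ⊎ (i ≡ 33 × j ≡ 1) ⊎ i ≡ 11 ⊎ j ≡ 11
factors-of-33 i j =
  divisor-search (λ i → i) (λ _ → ≤-refl) 33
    (λ i j → ((i ≟ 1) ×-dec (j ≟ 33)) ⊎-dec ((i ≟ 33) ×-dec (j ≟ 1)) ⊎-dec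
             (i ≟ 11) ⊎-dec (j ≟ 11))
    {i = i} {j}

¬prime[15] : ¬ Prime 15
¬prime[15] = from-no (prime? 15)

-- The factorisation 33 = 3 · 11 would give the divisor 4 + 11 = 15, which is odd but not prime.
balance-1qr1 : ∀ i j → Prime (3 + i) → Prime (3 + j) → Balance 1 (3 + i) (3 + j) 1 →
               (i ≡ 2 × j ≡ 34) ⊎ (i ≡ 34 × j ≡ 2)
balance-1qr1 zero    j       _       _       eq = contradiction eq (¬balance-13r1 (3 + j))
balance-1qr1 (suc i) zero    _       _       eq = contradiction eq (¬balance-1q31 (4 + i))
balance-1qr1 (suc i) (suc j) prime-q prime-r eq =
  select prime-q prime-r (factors-of-33 i j (balance-1qr1-product i j eq))
  where
  select : ∀ {i j} → Prime (4 + i) → Prime (4 + j) →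
           (i ≡ 1 × j ≡ 33) ⊎ (i ≡ 33 × j ≡ 1) ⊎ i ≡ 11 ⊎ j ≡ 11 →
           (suc i ≡ 2 × suc j ≡ 34) ⊎ (suc i ≡ 34 × suc j ≡ 2)
  select _ _ (inj₁ (refl , refl))                = inj₁ (refl , refl)
  select _ _ (inj₂ (inj₁ (refl , refl)))         = inj₂ (refl , refl)
  select prime-15 _ (inj₂ (inj₂ (inj₁ refl)))    = contradiction prime-15 ¬prime[15]
  select _ prime-15 (inj₂ (inj₂ (inj₂ refl)))    = contradiction prime-15 ¬prime[15]

-- Exclusion of the remaining quadruples

prime∣prime : ∀ {m n} → Prime m → Prime n → m ∣ n → m ≡ n
prime∣prime {m} prime-m prime-n m∣n with prime⇒irreducible prime-n m∣n
... | inj₁ refl = contradiction prime-m ¬prime[1]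
... | inj₂ m≡n  = m≡n

abstract
  -- Fixes the scale: `n` divides `y * l`, hence `x * k`, hence the prime `x`.
  prime-factor : ∀ n x k y l {prime-n : True (prime? n)} {n∤k : True (¬? (n ∣? k))} {n∣l : True (n ∣? l)} →
                 Prime x → x * k ≡ y * l → x ≡ n
  prime-factor n x k y l {prime-n} {n∤k} {n∣l} prime-x eq
    with euclidsLemma x k (toWitness prime-n) (subst (n ∣_) (sym eq) (∣n⇒∣m*n y (toWitness n∣l)))
  ... | inj₁ n∣x = sym (prime∣prime (toWitness prime-n) prime-x n∣x)
  ... | inj₂ n∣k = contradiction n∣k (toWitness n∤k)

  quotient-value : ∀ z c n → .{{NonZero c}} → z * c ≡ n * c → z ≡ n
  quotient-value z c n = *-cancelʳ-≡ z n c

  collect : ∀ x {m n k} → x * (m + n) ≡ x * m + k → x * n ≡ k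
  collect x {m} {n} eq = +-cancelˡ-≡ (x * m) _ _ (trans (sym (*-distribˡ-+ x m n)) eq)

divisor-1 : ∀ {s} → Divisor s 1 → Prime s
divisor-1 (one prime-s)           = prime-s
divisor-1 (least _ (prime-1 , _)) = contradiction prime-1 ¬prime[1]

-- The divisor 1 occurs only for a prime sum, and the next term is then that sum.
x-prime : ∀ {q r s x y u v} → Alternating 1 q r s x y u v → Prime x
x-prime {x = x} α = subst Prime (trans (sym u-eq) (*-identityʳ x)) (divisor-1 u-div)
  where open Arc (Alternating.back α)

y-prime : ∀ {p r s x y u v} → Alternating p 1 r s x y u v → Prime y
y-prime {y = y} α = subst Prime (trans (sym v-eq) (*-identityʳ y)) (divisor-1 v-div)
  where open Arc (Alternating.back α)

-- The model for the other exclusions. `x-return` reads `x * 84 ≡ x * 19 + y * 39`, so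
-- `x * 65 ≡ y * 39`. As `x` is prime, the terms are 3, 5, 4, 3; the next sum 7 is prime and cannot
-- have the divisor 7 taken out.
¬alternating-1137 : ∀ {x y u v} → ¬ Alternating 1 1 3 7 x y u v
¬alternating-1137 {x} {y} {u} α@(alternating (arc b b-eq u-eq _ v-eq v-div) _ _ _)
  with ratio ← collect x {19} {65} (x-return α)
  with refl ← prime-factor 3 x 65 y 39 (x-prime α) ratio
  with refl ← quotient-value y 39 5 (sym ratio)
  with refl ← quotient-value b 2 4 b-eq
  with refl ← quotient-value u 3 3 u-eq
  with least composite-7 _ ← v-div
  = contradiction composite-7 (from-no (composite? 7))

-- The terms are 13, 19, 16, and the sum 35 would be divided by 7 instead of 5.
¬alternating-1173 : ∀ {x y u v} → ¬ Alternating 1 1 7 3 x y u v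
¬alternating-1173 {x} {y} {u} α@(alternating (arc b b-eq u-eq u-div _ _) _ _ _)
  with ratio ← collect x {27} {57} (x-return α)
  with refl ← prime-factor 13 x 57 y 39 (x-prime α) ratio
  with refl ← quotient-value y 39 19 (sym ratio)
  with refl ← quotient-value b 2 16 b-eq
  with least _ (_ , _ , minimal) ← u-div
  = contradiction (minimal 5 (from-yes (prime? 5)) (divides 7 refl)) (from-no (7 ≤? 5))

¬alternating-1-5-37-1 : ∀ {x y u v} → ¬ Alternating 1 5 37 1 x y u v
¬alternating-1-5-37-1 {x} {y} {u} α@(alternating (arc b b-eq u-eq _ v-eq v-div) _ _ _)
  with ratio ← collect x {115} {33} (x-return α)
  with refl ← prime-factor 41 x 33 y 123 (x-prime α) ratio
  with refl ← quotient-value y 123 11 (sym ratio)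
  with refl ← quotient-value b 2 26 b-eq
  with refl ← quotient-value u 37 1 u-eq
  = contradiction (divisor-1 v-div) (from-no (prime? 27))

-- The ratio makes the prime `x` a multiple of 27.
¬alternating-1-37-5-1 : ∀ {x y u v} → ¬ Alternating 1 37 5 1 x y u v
¬alternating-1-37-5-1 {x} {y} α
  with ratio ← collect x {19} {1} (x-return α)
  with refl ← prime-factor 3 x 1 y 27 (x-prime α) ratio
  = contradiction (divides y ratio) (from-no (27 ∣? 3))

¬alternating-1-5-1-5 : ∀ {x y u v} → ¬ Alternating 1 5 1 5 x y u v
¬alternating-1-5-1-5 {x} {y} {u} α@(alternating (arc b b-eq u-eq _ v-eq v-div) _ _ _)
  with ratio ← collect x {11} {9} (x-return α)
  -- `prime-factor` needs a prime that does not divide the coefficient of `x`, so the common factor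
  -- 9 of 9 and 27 is cancelled first.
  with ratio′ ← quotient-value (x * 1) 9 (y * 3) (trans (*-assoc x 1 9) (trans ratio (sym (*-assoc y 3 9))))
  with refl ← prime-factor 3 x 1 y 3 (x-prime α) ratio′
  with refl ← quotient-value y 3 1 (sym ratio′)
  with refl ← quotient-value b 2 2 b-eq
  with refl ← quotient-value u 1 3 u-eq
  with least composite-5 _ ← v-div
  = contradiction composite-5 (from-no (composite? 5))

¬alternating-1-3-1-11 : ∀ {x y u v} → ¬ Alternating 1 3 1 11 x y u v
¬alternating-1-3-1-11 {x} {y} {u} α@(alternating (arc b b-eq u-eq _ v-eq v-div) _ _ _)
  with ratio ← collect x {17} {27} (x-return α)
  with refl ← prime-factor 5 x 27 y 45 (x-prime α) ratio
  with refl ← quotient-value y 45 3 (sym ratio)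
  with refl ← quotient-value b 2 4 b-eq
  with refl ← quotient-value u 1 7 u-eq
  with least composite-11 _ ← v-div
  = contradiction composite-11 (from-no (composite? 11))

-- Here `q` rather than `p` is 1, so the scale comes from the prime `y`.
¬alternating-5-1-5-1 : ∀ {x y u v} → ¬ Alternating 5 1 5 1 x y u v
¬alternating-5-1-5-1 {x} {y} {u} α@(alternating (arc b b-eq u-eq u-div _ _) _ _ _)
  with ratio ← collect x {19} {81} (x-return α)
  with ratio′ ← quotient-value (y * 1) 27 (x * 3) (trans (*-assoc y 1 27) (trans (sym ratio) (sym (*-assoc x 3 27))))
  with refl ← prime-factor 3 y 1 x 3 (y-prime α) ratio′
  with refl ← quotient-value x 3 1 (sym ratio′)
  with refl ← quotient-value b 2 2 b-eq
  with least composite-5 _ ← u-div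
  = contradiction composite-5 (from-no (composite? 5))

¬alternating-3-1-11-1 : ∀ {x y u v} → ¬ Alternating 3 1 11 1 x y u v
¬alternating-3-1-11-1 {x} {y} {u} α@(alternating (arc b b-eq u-eq u-div _ _) _ _ _)
  with ratio ← collect x {37} {95} (x-return α)
  with refl ← prime-factor 19 y 45 x 95 (y-prime α) (sym ratio)
  with refl ← quotient-value x 95 9 ratio
  with refl ← quotient-value b 2 14 b-eq
  with least _ (_ , _ , minimal) ← u-div
  = contradiction (minimal 3 (from-yes (prime? 3)) (divides 11 refl)) (from-no (11 ≤? 3))

¬alternating-11rs : ∀ i j {x y u v} → ¬ Alternating 1 1 (3 + i) (3 + j) x y u v
¬alternating-11rs i j α = exclude (balance-11rs i j (balance α)) α
  where
  exclude : ∀ {i j x y u v} → (i ≡ 0 × j ≡ 4) ⊎ (i ≡ 4 × j ≡ 0) →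
            ¬ Alternating 1 1 (3 + i) (3 + j) x y u v
  exclude (inj₁ (refl , refl)) = ¬alternating-1137
  exclude (inj₂ (refl , refl)) = ¬alternating-1173

¬alternating-1qr1 : ∀ i j {x y u v} → Prime (3 + i) → Prime (3 + j) →
                    ¬ Alternating 1 (3 + i) (3 + j) 1 x y u v
¬alternating-1qr1 i j prime-q prime-r α = exclude (balance-1qr1 i j prime-q prime-r (balance α)) α
  where
  exclude : ∀ {i j x y u v} → (i ≡ 2 × j ≡ 34) ⊎ (i ≡ 34 × j ≡ 2) →
            ¬ Alternating 1 (3 + i) (3 + j) 1 x y u v
  exclude (inj₁ (refl , refl)) = ¬alternating-1-5-37-1
  exclude (inj₂ (refl , refl)) = ¬alternating-1-37-5-1

¬alternating-1q1s : ∀ i j {x y u v} → ¬ Alternating 1 (3 + i) 1 (3 + j) x y u v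
¬alternating-1q1s i j α = exclude (balance-1q1s i j (balance α)) α
  where
  exclude : ∀ {q s x y u v} → ProductNine q s → ¬ Alternating 1 q 1 s x y u v
  exclude 3,11 = ¬alternating-1-3-1-11
  exclude 5,5  = ¬alternating-1-5-1-5
  exclude 11,3 = ¬alternating-1-3-1-11 ∘ swap

¬alternating-p1r1 : ∀ i j {x y u v} → ¬ Alternating (3 + i) 1 (3 + j) 1 x y u v
¬alternating-p1r1 i j α = exclude (balance-p1r1 i j (balance α)) α
  where
  exclude : ∀ {p r x y u v} → ProductNine p r → ¬ Alternating p 1 r 1 x y u v
  exclude 3,11 = ¬alternating-3-1-11-1
  exclude 5,5  = ¬alternating-5-1-5-1
  exclude 11,3 = ¬alternating-3-1-11-1 ∘ swap

-- Three large divisors make the left side of `Balance` too big, three units too small. With exactly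
-- two units, `swap` leaves four families.
¬alternating : ∀ {p q r s x y u v} → OddDivisor p → OddDivisor q → OddDivisor r → OddDivisor s →
               ¬ Alternating p q r s x y u v
¬alternating (large i _) (large j _) (large k _) unit        α = ¬three-large′ k 0 i j (balance (swap α))
¬alternating (large i _) (large j _) (large k _) (large l _) α = ¬three-large (2 + i) j k l (balance α)
¬alternating (large i _) (large j _) unit        (large l _) α = ¬three-large 0 l i j (balance (swap α))
¬alternating (large i _) (large j _) unit        unit        α = ¬alternating-11rs i j (swap α)
¬alternating (large i _) unit        (large k _) (large l _) α = ¬three-large′ i 0 k l (balance α)
¬alternating (large i _) unit        (large k _) unit        α = ¬alternating-p1r1 i k α
¬alternating (large i p) unit        unit        (large l s) α = ¬alternating-1qr1 l i s p (swap α)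
¬alternating (large i _) unit        unit        unit        α = ¬three-units (3 + i) (balance α)
¬alternating unit        (large j _) (large k _) (large l _) α = ¬three-large 0 j k l (balance α)
¬alternating unit        (large j q) (large k r) unit        α = ¬alternating-1qr1 j k q r α
¬alternating unit        (large j _) unit        (large l _) α = ¬alternating-1q1s j l α
¬alternating unit        (large j _) unit        unit        α = ¬three-units′ (3 + j) (balance α)
¬alternating unit        unit        (large k _) (large l _) α = ¬alternating-11rs k l α
¬alternating unit        unit        (large k _) unit        α = ¬three-units (3 + k) (balance (swap α))
¬alternating unit        unit        unit        (large l _) α = ¬three-units′ (3 + l) (balance (swap α))
¬alternating unit        unit        unit        unit        α = ¬three-units 1 (balance α)

-- Parity

even⇒2∣ : ∀ n → 0ℙ ≡ parity n → 2 ∣ n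
even⇒2∣ zero          _    = 2 ∣0
even⇒2∣ (suc (suc n)) even = ∣m∣n⇒∣m+n ∣-refl (even⇒2∣ n even)

odd-prime : ∀ {p} → Prime p → parity p ≡ 1ℙ → OddDivisor p
odd-prime {0} prime-0 _ = contradiction prime-0 ¬prime[0]
odd-prime {1} prime-1 _ = contradiction prime-1 ¬prime[1]
odd-prime {suc (suc (suc i))} prime-p _ = large i prime-p

odd-factors : ∀ m n → parity (m * n) ≡ 1ℙ → parity m ≡ 1ℙ × parity n ≡ 1ℙ
odd-factors m n odd with parity m | parity n | trans (sym (*-homo-* m n)) odd
... | 1ℙ | 1ℙ | refl = refl , refl

-- An even prime sum is 2, which happens only for 1 + 1; any other even sum has smallest prime
-- factor 2.
step-halves : ∀ x y z → 0 < x → 0 < y → ¬ (x ≡ 1 × y ≡ 1) → SubprimeStep x y z →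
              parity x ≡ parity y → z * 2 ≡ x + y
step-halves x y z x>0 y>0 ≢1,1 step same = halve step
  where
  even : 2 ∣ x + y
  even = even⇒2∣ (x + y) (sym (trans (+-homo-+ x y) (trans (cong (ℙ._+ parity y) same) (ℙ-double (parity y)))))
    where
    ℙ-double : ∀ p → p ℙ.+ p ≡ 0ℙ
    ℙ-double 0ℙ = refl
    ℙ-double 1ℙ = refl
  ones : ∀ {x y} → 0 < x → 0 < y → 2 ≡ x + y → x ≡ 1 × y ≡ 1
  ones {1} {1} _ _ _ = refl , refl
  ones {suc (suc x)} {suc y} _ _ eq with () ← trans eq (cong (suc ∘ suc) (+-suc x y))
  halve : SubprimeStep x y z → z * 2 ≡ x + y
  halve (inj₁ (prime-s , _)) = contradiction (ones x>0 y>0 (prime∣prime prime[2] prime-s even)) ≢1,1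
  halve (inj₂ (_ , p , (prime-p , _ , minimal) , eq)) = subst (λ p → z * p ≡ x + y) p≡2 eq
    where
    p≡2 : p ≡ 2
    p≡2 = ≤-antisym (minimal 2 prime[2] even) (nonTrivial⇒n>1 p {{prime⇒nonTrivial prime-p}})

record OddStep (x y z : ℕ) : Set where
  constructor oddStep
  field
    {p}   : ℕ
    odd-p : OddDivisor p
    div   : Divisor (x + y) p
    eq    : z * p ≡ x + y
    odd-z : parity z ≡ 1ℙ

-- An odd product has odd factors, so the divisor and the new term are both odd.
step-odd : ∀ x y {z} → SubprimeStep x y z → parity (x + y) ≡ 1ℙ → OddStep x y z
step-odd _ _ {z} (inj₁ (prime-s , eq)) odd =
  oddStep unit (one prime-s) (trans (*-identityʳ z) eq) (trans (cong parity eq) odd)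
step-odd _ _ {z} (inj₂ (composite-s , p , spf , eq)) odd
  with odd-z , odd-p ← odd-factors z p (trans (cong parity eq) odd) =
  oddStep (odd-prime (proj₁ spf) odd-p) (least composite-s spf) eq odd-z

parity-+ : ∀ x y {p q} → parity x ≡ p → parity y ≡ q → parity (x + y) ≡ p ℙ.+ q
parity-+ x y refl refl = +-homo-+ x y

step-prime : ∀ x y {z} → Prime (x + y) → SubprimeStep x y z → z ≡ x + y
step-prime _ _ prime-s (inj₁ (_ , eq))          = eq
step-prime _ _ prime-s (inj₂ (composite-s , _)) = contradiction prime-s (composite⇒¬prime composite-s)

-- Cycles with four consecutive halvings

-- Expresses `e`, `f`, `a` in turn through `b` and `c`. The sums `f + a` and `a + b` are those from
-- which the rule forms `b` and `c`.
four-averages : ∀ a b c d e f → d * 2 ≡ b + c → e * 2 ≡ c + d → f * 2 ≡ d + e → a * 2 ≡ e + f →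
                (f + a) * 16 ≡ b * 11 + c * 21 × (a + b) * 16 ≡ b * 21 + c * 11
four-averages a b c d e f d-eq e-eq f-eq a-eq =
  trans (lemma₅ a f) (trans (cong₂ (λ m n → m * 2 + n) f*8 a*16) (lemma₆ b c)) ,
  trans (*-distribʳ-+ 16 a b) (trans (cong (_+ b * 16) a*16) (lemma₇ b c))
  where
  open ≡-Reasoning
  lemma₁ : ∀ b c → c * 2 + (b + c) ≡ b + c * 3
  lemma₁ = solve-∀
  lemma₂ : ∀ d e → (d + e) * 4 ≡ d * 2 * 2 + e * 4
  lemma₂ = solve-∀
  lemma₃ : ∀ b c → (b + c) * 2 + (b + c * 3) ≡ b * 3 + c * 5
  lemma₃ = solve-∀
  lemma₄ : ∀ b c → (b + c * 3) * 2 + (b * 3 + c * 5) ≡ b * 5 + c * 11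
  lemma₄ = solve-∀
  lemma₅ : ∀ a f → (f + a) * 16 ≡ f * 8 * 2 + a * 16
  lemma₅ = solve-∀
  lemma₆ : ∀ b c → (b * 3 + c * 5) * 2 + (b * 5 + c * 11) ≡ b * 11 + c * 21
  lemma₆ = solve-∀
  lemma₇ : ∀ b c → b * 5 + c * 11 + b * 16 ≡ b * 21 + c * 11
  lemma₇ = solve-∀
  lemma₈ : ∀ e f → (e + f) * 8 ≡ e * 4 * 2 + f * 8
  lemma₈ = solve-∀
  e*4 : e * 4 ≡ b + c * 3
  e*4 = begin
    e * 4          ≡⟨ *-assoc e 2 2 ⟨
    e * 2 * 2      ≡⟨ cong (_* 2) e-eq ⟩
    (c + d) * 2    ≡⟨ *-distribʳ-+ 2 c d ⟩
    c * 2 + d * 2  ≡⟨ cong (c * 2 +_) d-eq ⟩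
    c * 2 + (b + c) ≡⟨ lemma₁ b c ⟩
    b + c * 3      ∎
  f*8 : f * 8 ≡ b * 3 + c * 5
  f*8 = begin
    f * 8                ≡⟨ *-assoc f 2 4 ⟨
    f * 2 * 4            ≡⟨ cong (_* 4) f-eq ⟩
    (d + e) * 4          ≡⟨ lemma₂ d e ⟩
    d * 2 * 2 + e * 4    ≡⟨ cong₂ (λ m n → m * 2 + n) d-eq e*4 ⟩
    (b + c) * 2 + (b + c * 3) ≡⟨ lemma₃ b c ⟩
    b * 3 + c * 5        ∎
  a*16 : a * 16 ≡ b * 5 + c * 11
  a*16 = begin
    a * 16               ≡⟨ *-assoc a 2 8 ⟨
    a * 2 * 8            ≡⟨ cong (_* 8) a-eq ⟩
    (e + f) * 8          ≡⟨ lemma₈ e f ⟩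
    e * 4 * 2 + f * 8    ≡⟨ cong₂ (λ m n → m * 2 + n) e*4 f*8 ⟩
    (b + c * 3) * 2 + (b * 3 + c * 5) ≡⟨ lemma₄ b c ⟩
    b * 5 + c * 11       ∎

-- (16 p − 11) (16 q − 11) = 21² has no solution in odd p, q.
¬two-odd-divisors : ∀ p q b c → OddDivisor p → OddDivisor q → 0 < b → 0 < c →
                    b * p * 16 ≡ b * 11 + c * 21 → ¬ c * q * 16 ≡ b * 21 + c * 11
¬two-odd-divisors _ q b c unit _ _ c>0 eq₁ eq₂ = ¬unit q b c c>0 (collect b {11} {5} (trans (sym (*-assoc b 1 16)) eq₁)) eq₂
  where
  ¬unit : ∀ q b c → 0 < c → b * 5 ≡ c * 21 → ¬ c * q * 16 ≡ b * 21 + c * 11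
  ¬unit q b c c>0 eq₁ eq₂ = from-no (80 ∣? 496) (divides q (sym (*-cancelˡ-≡ (q * 80) 496 c {{>-nonZero c>0}} (begin
    c * (q * 80)                ≡⟨ lemma₁ c q ⟩
    c * q * 16 * 5              ≡⟨ cong (_* 5) eq₂ ⟩
    (b * 21 + c * 11) * 5       ≡⟨ lemma₂ b c ⟩
    b * 5 * 21 + c * 55         ≡⟨ cong (λ n → n * 21 + c * 55) eq₁ ⟩
    c * 21 * 21 + c * 55        ≡⟨ lemma₃ c ⟩
    c * 496                     ∎))))
    where
    open ≡-Reasoning
    lemma₁ : ∀ c q → c * (q * 80) ≡ c * q * 16 * 5
    lemma₁ = solve-∀
    lemma₂ : ∀ b c → (b * 21 + c * 11) * 5 ≡ b * 5 * 21 + c * 55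
    lemma₂ = solve-∀
    lemma₃ : ∀ c → c * 21 * 21 + c * 55 ≡ c * 496
    lemma₃ = solve-∀
¬two-odd-divisors p _ b c (large i prime-p) unit b>0 c>0 eq₁ eq₂ =
  -- The two equations are exchanged when `(b , p)` and `(c , q)` trade places.
  ¬two-odd-divisors 1 p c b unit (large i prime-p) c>0 b>0
    (trans eq₂ (+-comm (b * 21) (c * 11))) (trans eq₁ (+-comm (b * 11) (c * 21)))
¬two-odd-divisors _ _ b c (large i _) (large j _) b>0 c>0 eq₁ eq₂ =
  -- For divisors at least 3, 16 p - 11 is at least 16 · 3 - 11 = 37, so 37 b ≤ 21 c and 37 c ≤ 21
  -- b; these are added.
  from-no (37 ≤? 21) (*-cancelˡ-≤ (b + c) {{>-nonZero (≤-trans b>0 (m≤m+n b c))}} (begin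
    (b + c) * 37         ≡⟨ *-distribʳ-+ 37 b c ⟩
    b * 37 + c * 37      ≤⟨ +-mono-≤ (bound i b (c * 21) eq₁) (bound j c (b * 21) (trans eq₂ (+-comm (b * 21) (c * 11)))) ⟩
    c * 21 + b * 21      ≡⟨ *-distribʳ-+ 21 c b ⟨
    (c + b) * 21         ≡⟨ cong (_* 21) (+-comm c b) ⟩
    (b + c) * 21         ∎))
  where
  open ≤-Reasoning
  expand : ∀ i b → b * 11 + (b * 37 + b * (i * 16)) ≡ b * (3 + i) * 16
  expand = solve-∀
  bound : ∀ i b k → b * (3 + i) * 16 ≡ b * 11 + k → b * 37 ≤ k
  bound i b k eq = subst (b * 37 ≤_) (+-cancelˡ-≡ (b * 11) _ _ (trans (expand i b) eq)) (m≤m+n _ _)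

-- Six-term cycles and their parity patterns

-- Six named terms make rotation a relabelling instead of arithmetic on indices modulo 6.
record Hexagon (a b c d e f : ℕ) : Set where
  field
    a>0 : 0 < a
    b>0 : 0 < b
    c>0 : 0 < c
    d>0 : 0 < d
    e>0 : 0 < e
    f>0 : 0 < f
    c-step : SubprimeStep a b c
    d-step : SubprimeStep b c d
    e-step : SubprimeStep c d e
    f-step : SubprimeStep d e f
    a-step : SubprimeStep e f a
    b-step : SubprimeStep f a b
    nonconst : ¬ (a ≡ b × b ≡ c × c ≡ d × d ≡ e × e ≡ f)

rotate : ∀ {a b c d e f} → Hexagon a b c d e f → Hexagon b c d e f a
rotate h = record
  { a>0 = b>0 ; b>0 = c>0 ; c>0 = d>0 ; d>0 = e>0 ; e>0 = f>0 ; f>0 = a>0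
  ; c-step = d-step ; d-step = e-step ; e-step = f-step ; f-step = a-step ; a-step = b-step ; b-step = c-step
  ; nonconst = λ { (refl , refl , refl , refl , refl) → nonconst (refl , refl , refl , refl , refl) }
  }
  where open Hexagon h

-- The rule continues 1, 1 with 2, 3, 5, 4. A return to 1 would divide 9 by itself, but 9 is not
-- prime. This removes the exception in `step-halves`.
¬hexagon-11 : ∀ {c d e f} → ¬ Hexagon 1 1 c d e f
¬hexagon-11 {f = f} h
  with refl ← step-prime 1 1 (from-yes (prime? 2)) (Hexagon.c-step h)
  with refl ← step-prime 1 2 (from-yes (prime? 3)) (Hexagon.d-step h)
  with refl ← step-prime 2 3 (from-yes (prime? 5)) (Hexagon.e-step h)
  with refl ← quotient-value f 2 4 (step-halves 3 5 f (s≤s z≤n) (s≤s z≤n) (λ ()) (Hexagon.f-step h) refl)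
  with Hexagon.a-step h
... | inj₁ (prime-9 , _)                      = contradiction prime-9 (from-no (prime? 9))
... | inj₂ (_ , p , (prime-p , _) , p≡9)      =
  contradiction (subst Prime (trans (sym (*-identityˡ p)) p≡9) prime-p) (from-no (prime? 9))

c-halves : ∀ {a b c d e f} → Hexagon a b c d e f → parity a ≡ parity b → c * 2 ≡ a + b
c-halves {a} {b} {c} h = step-halves a b c a>0 b>0 (λ { (refl , refl) → ¬hexagon-11 h }) c-step
  where open Hexagon h

mean-self : ∀ z x → z * 2 ≡ x + x → z ≡ x
mean-self z x eq = *-cancelʳ-≡ z x 2 (trans eq (trans (cong (x +_) (sym (+-identityʳ x))) (*-comm 2 x)))

-- The halving for `b` turns `four-averages` into `b * 32 ≡ b * 11 + c * 21`. Hence `b ≡ c`, and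
-- repeated means of equal terms make the cycle constant.
¬all-halve : ∀ {a b c d e f} → Hexagon a b c d e f →
             d * 2 ≡ b + c → e * 2 ≡ c + d → f * 2 ≡ d + e → a * 2 ≡ e + f → ¬ b * 2 ≡ f + a
¬all-halve {a} {b} {c} {d} {e} {f} h d-eq e-eq f-eq a-eq b-eq =
  Hexagon.nonconst h (trans a≡c (sym b≡c) , b≡c , sym d≡c , trans d≡c (sym e≡c) , trans e≡c (sym f≡c))
  where
  open ≡-Reasoning
  b≡c : b ≡ c
  b≡c = *-cancelʳ-≡ b c 21 (collect b {11} {21} (begin
    b * 32           ≡⟨ *-assoc b 2 16 ⟨
    b * 2 * 16       ≡⟨ cong (_* 16) b-eq ⟩
    (f + a) * 16     ≡⟨ proj₁ (four-averages a b c d e f d-eq e-eq f-eq a-eq) ⟩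
    b * 11 + c * 21  ∎))
  mean : ∀ z {x y} → x ≡ c → y ≡ c → z * 2 ≡ x + y → z ≡ c
  mean z refl refl = mean-self z c
  d≡c = mean d b≡c refl d-eq
  e≡c = mean e refl d≡c e-eq
  f≡c = mean f d≡c e≡c f-eq
  a≡c = mean a e≡c f≡c a-eq

¬equal-parities : ∀ {a b c d e f} → Hexagon a b c d e f → ∀ {p} →
                  parity a ≡ p → parity b ≡ p → parity c ≡ p → parity d ≡ p → parity e ≡ p → ¬ parity f ≡ p
¬equal-parities h₀ a b c d e f =
  ¬all-halve h₀ (c-halves h₁ (trans b (sym c))) (c-halves h₂ (trans c (sym d)))
                (c-halves h₃ (trans d (sym e))) (c-halves h₄ (trans e (sym f))) (c-halves h₅ (trans f (sym a)))
  where
  h₁ = rotate h₀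
  h₂ = rotate h₁
  h₃ = rotate h₂
  h₄ = rotate h₃
  h₅ = rotate h₄

before-two-evens : ∀ {a b c d e f} → Hexagon a b c d e f → parity a ≡ 0ℙ → parity b ≡ 0ℙ → parity f ≡ 0ℙ
before-two-evens {a = a} {f = f} h even-a even-b with parity f in parity-f
... | 0ℙ = refl
... | 1ℙ with () ← trans (sym even-b) (OddStep.odd-z (step-odd f a (Hexagon.b-step h) (parity-+ f a parity-f even-a)))

-- Two adjacent even terms force the term before them to be even, and so on backwards around the
-- cycle until all parities agree.
after-even : ∀ {a b c d e f} → Hexagon a b c d e f → parity a ≡ 0ℙ → parity b ≡ 1ℙ × parity c ≡ 1ℙ
after-even {a} {b} h₀ even-a with parity b in parity-b
... | 1ℙ = refl , OddStep.odd-z (step-odd a b (Hexagon.c-step h₀) (parity-+ a b even-a parity-b))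
... | 0ℙ = ⊥-elim (¬equal-parities h₀ even-a parity-b even-c even-d even-e even-f)
  where
  h₅ = rotate (rotate (rotate (rotate (rotate h₀))))
  h₄ = rotate (rotate (rotate (rotate h₀)))
  h₃ = rotate (rotate (rotate h₀))
  even-f = before-two-evens h₀ even-a parity-b
  even-e = before-two-evens h₅ even-f even-a
  even-d = before-two-evens h₄ even-e even-f
  even-c = before-two-evens h₃ even-d even-e

-- An even `e` or `f` would make `a` odd by `after-even`, so only the parity of `d` is open: odd
-- gives EOOOOO, even gives EOOEOO.
¬even-first : ∀ {a b c d e f} → Hexagon a b c d e f → ¬ parity a ≡ 0ℙ
¬even-first {a} {b} {c} {d} {e} {f} h₀ even-a
  with odd-b , odd-c ← after-even h₀ even-a
  with parity e in parity-e | parity f in parity-f | parity d in parity-d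
... | 0ℙ | _ | _ with () ← trans (sym even-a) (proj₂ (after-even (rotate (rotate (rotate (rotate h₀)))) parity-e))
... | 1ℙ | 0ℙ | _ with () ← trans (sym even-a) (proj₁ (after-even (rotate (rotate (rotate (rotate (rotate h₀))))) parity-f))
... | 1ℙ | 1ℙ | 1ℙ = ¬two-odd-divisors B.p C.p b c B.odd-p C.odd-p b>0 c>0
    (trans (cong (_* 16) B.eq) (proj₁ averages)) (trans (cong (_* 16) C.eq) (proj₂ averages))
  where
  open Hexagon h₀
  module B = OddStep (step-odd f a b-step (parity-+ f a parity-f even-a))
  module C = OddStep (step-odd a b c-step (parity-+ a b even-a odd-b))
  h₁ = rotate h₀
  h₂ = rotate h₁
  h₃ = rotate h₂
  h₄ = rotate h₃
  averages = four-averages a b c d e f (c-halves h₁ (trans odd-b (sym odd-c))) (c-halves h₂ (trans odd-c (sym parity-d)))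
                           (c-halves h₃ (trans parity-d (sym parity-e))) (c-halves h₄ (trans parity-e (sym parity-f)))
... | 1ℙ | 1ℙ | 0ℙ =
  -- One arc leads from `(b , c)` over `d` to `(e , f)`, the other over `a` back to `(b , c)`.
  ¬alternating B.odd-p C.odd-p E.odd-p F.odd-p (alternating
    (arc d (c-halves (rotate h₀) (trans odd-b (sym odd-c))) E.eq E.div F.eq F.div)
    (arc a (c-halves (rotate (rotate (rotate (rotate h₀)))) (trans parity-e (sym parity-f))) B.eq B.div C.eq C.div)
    b>0 e>0)
  where
  open Hexagon h₀
  module B = OddStep (step-odd f a b-step (parity-+ f a parity-f even-a))
  module C = OddStep (step-odd a b c-step (parity-+ a b even-a odd-b))
  module E = OddStep (step-odd c d e-step (parity-+ c d odd-c parity-d))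
  module F = OddStep (step-odd d e f-step (parity-+ d e parity-d parity-e))

¬hexagon : ∀ {a b c d e f} → ¬ Hexagon a b c d e f
¬hexagon {a} {b} {c} {d} {e} {f} h₀
  with parity a in a≡ | parity b in b≡ | parity c in c≡ | parity d in d≡ | parity e in e≡ | parity f in f≡
... | 0ℙ | _  | _  | _  | _  | _  = ¬even-first h₀ a≡
... | 1ℙ | 0ℙ | _  | _  | _  | _  = ¬even-first (rotate h₀) b≡
... | 1ℙ | 1ℙ | 0ℙ | _  | _  | _  = ¬even-first (rotate (rotate h₀)) c≡
... | 1ℙ | 1ℙ | 1ℙ | 0ℙ | _  | _  = ¬even-first (rotate (rotate (rotate h₀))) d≡
... | 1ℙ | 1ℙ | 1ℙ | 1ℙ | 0ℙ | _  = ¬even-first (rotate (rotate (rotate (rotate h₀)))) e≡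
... | 1ℙ | 1ℙ | 1ℙ | 1ℙ | 1ℙ | 0ℙ = ¬even-first (rotate (rotate (rotate (rotate (rotate h₀))))) f≡
... | 1ℙ | 1ℙ | 1ℙ | 1ℙ | 1ℙ | 1ℙ = ¬equal-parities h₀ a≡ b≡ c≡ d≡ e≡ f≡

theorem14 : (t : ℕ → ℕ) → ¬ NontrivialCycle 6 t
theorem14 t cycle = ¬hexagon hexagon
  where
  open NontrivialCycle cycle
  hexagon : Hexagon (t 0) (t 1) (t 2) (t 3) (t 4) (t 5)
  hexagon = record
    { a>0 = positive 0 ; b>0 = positive 1 ; c>0 = positive 2
    ; d>0 = positive 3 ; e>0 = positive 4 ; f>0 = positive 5
    ; c-step = rule 0 ; d-step = rule 1 ; e-step = rule 2 ; f-step = rule 3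
    ; a-step = subst (SubprimeStep (t 4) (t 5)) (periodic 0) (rule 4)
    ; b-step = subst₂ (SubprimeStep (t 5)) (periodic 0) (periodic 1) (rule 5)
    ; nonconst = λ (01≡ , 12≡ , 23≡ , 34≡ , 45≡) →
        let 1≡ = sym 01≡
            2≡ = trans (sym 12≡) 1≡
            3≡ = trans (sym 23≡) 2≡
            4≡ = trans (sym 34≡) 3≡
            5≡ = trans (sym 45≡) 4≡
            const = constant 1≡ 2≡ 3≡ 4≡ 5≡
            i , j , t-i≢t-j = nonconst
        in t-i≢t-j (trans (const i) (sym (const j)))
    }
    where
    constant : t 1 ≡ t 0 → t 2 ≡ t 0 → t 3 ≡ t 0 → t 4 ≡ t 0 → t 5 ≡ t 0 → ∀ i → t i ≡ t 0
    constant 1≡ 2≡ 3≡ 4≡ 5≡ = go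
      where
      go : ∀ i → t i ≡ t 0
      go 0 = refl
      go 1 = 1≡
      go 2 = 2≡
      go 3 = 3≡
      go 4 = 4≡
      go 5 = 5≡
      go (suc (suc (suc (suc (suc (suc i)))))) = trans (cong t (+-comm 6 i)) (trans (periodic i) (go i))
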